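{- Assume that bicartesian closed categories are complete for the $\beta\eta$-equational theory of the typed $\lambda$-calculus with products, sums, an empty type and function types. Let $\Gamma\vdash M:A$ and $\Gamma\vdash N:A$ be terms of this calculus such that $[\![M]\!]=[\![N]\!]$ in $[\mathcal{C}^{\mathrm{op}},\mathbf{Set}]_\times$ for every distributive category $\mathcal{C}$ (with finite products and coproducts) and every interpretation of the base types there. Then $\Gamma\vdash M=N:A$ is derivable in the $\beta\eta$-equational theory.
   Context: A category with finite products and coproducts is distributive if the canonical morphism $(a\times b)+(a\times c)\to a\times(b+c)$ is an isomorphism for all $a,b,c$. $[\mathcal{C}^{\mathrm{op}},\mathbf{Set}]_\times$ is the category of presheaves on $\mathcal{C}$ that send finite coproducts of $\mathcal{C}$ to finite products of sets, with natural transformations; for $\mathcal{C}$ distributive it is bicartesian closed, and types and terms are interpreted in it by its bicartesian closed structure (terminal object, products, initial object, coproducts, exponentials) given interpretations of base types as objects. Completeness of bicartesian closed categories means: if two terms are interpreted equally in every bicartesian closed category under every interpretation of base types, they are $\beta\eta$-equal. -}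

module Defs where

open import Level using (Level; _⊔_) renaming (suc to lsuc)
open import Data.Product as P using (Σ; _,_)
open import Relation.Binary using (IsEquivalence; Setoid)

record Category (o m e : Level) : Set (lsuc (o ⊔ m ⊔ e)) where
  infix  4 _≈_
  infixr 9 _∘_
  field
    Obj       : Set o
    Hom       : Obj → Obj → Set m
    _≈_       : ∀ {a b} → Hom a b → Hom a b → Set e
    ≈-equiv   : ∀ {a b} → IsEquivalence (_≈_ {a} {b})
    id        : ∀ {a} → Hom a a
    _∘_       : ∀ {a b c} → Hom b c → Hom a b → Hom a c
    identityˡ : ∀ {a b} {f : Hom a b} → id ∘ f ≈ f
    identityʳ : ∀ {a b} {f : Hom a b} → f ∘ id ≈ f
    assoc     : ∀ {a b c d} {f : Hom a b} {g : Hom b c} {h : Hom c d} →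
                (h ∘ g) ∘ f ≈ h ∘ (g ∘ f)
    ∘-resp-≈  : ∀ {a b c} {f f' : Hom b c} {g g' : Hom a b} →
                f ≈ f' → g ≈ g' → f ∘ g ≈ f' ∘ g'

module _ {o m e} (𝒞 : Category o m e) where
  open Category 𝒞

  record Terminal : Set (o ⊔ m ⊔ e) where
    field
      ⊤        : Obj
      !        : ∀ {a} → Hom a ⊤
      !-unique : ∀ {a} (f : Hom a ⊤) → f ≈ !

  record Initial : Set (o ⊔ m ⊔ e) where
    field
      ⊥        : Obj
      ¡        : ∀ {a} → Hom ⊥ a
      ¡-unique : ∀ {a} (f : Hom ⊥ a) → f ≈ ¡

  record Products : Set (o ⊔ m ⊔ e) where
    infixr 7 _×_
    field
      _×_       : Obj → Obj → Obj
      π₁        : ∀ {a b} → Hom (a × b) a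
      π₂        : ∀ {a b} → Hom (a × b) b
      ⟨_,_⟩     : ∀ {a b c} → Hom c a → Hom c b → Hom c (a × b)
      π₁-β      : ∀ {a b c} {f : Hom c a} {g : Hom c b} → π₁ ∘ ⟨ f , g ⟩ ≈ f
      π₂-β      : ∀ {a b c} {f : Hom c a} {g : Hom c b} → π₂ ∘ ⟨ f , g ⟩ ≈ g
      ⟨⟩-unique : ∀ {a b c} {f : Hom c a} {g : Hom c b} (h : Hom c (a × b)) →
                  π₁ ∘ h ≈ f → π₂ ∘ h ≈ g → h ≈ ⟨ f , g ⟩

    _⁂_ : ∀ {a b c d} → Hom a c → Hom b d → Hom (a × b) (c × d)
    f ⁂ g = ⟨ f ∘ π₁ , g ∘ π₂ ⟩

  record Coproducts : Set (o ⊔ m ⊔ e) where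
    infixr 6 _+_
    field
      _+_       : Obj → Obj → Obj
      i₁        : ∀ {a b} → Hom a (a + b)
      i₂        : ∀ {a b} → Hom b (a + b)
      [_,_]     : ∀ {a b c} → Hom a c → Hom b c → Hom (a + b) c
      i₁-β      : ∀ {a b c} {f : Hom a c} {g : Hom b c} → [ f , g ] ∘ i₁ ≈ f
      i₂-β      : ∀ {a b c} {f : Hom a c} {g : Hom b c} → [ f , g ] ∘ i₂ ≈ g
      []-unique : ∀ {a b c} {f : Hom a c} {g : Hom b c} (h : Hom (a + b) c) →
                  h ∘ i₁ ≈ f → h ∘ i₂ ≈ g → h ≈ [ f , g ]

  record Exponentials (prod : Products) : Set (o ⊔ m ⊔ e) where
    open Products prod
    infixr 5 _⇒_
    field
      _⇒_          : Obj → Obj → Obj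
      eval         : ∀ {b c} → Hom ((b ⇒ c) × b) c
      curry        : ∀ {a b c} → Hom (a × b) c → Hom a (b ⇒ c)
      curry-β      : ∀ {a b c} {f : Hom (a × b) c} → eval ∘ (curry f ⁂ id) ≈ f
      curry-unique : ∀ {a b c} {f : Hom (a × b) c} (h : Hom a (b ⇒ c)) →
                     eval ∘ (h ⁂ id) ≈ f → h ≈ curry f

  record BCCStructure : Set (o ⊔ m ⊔ e) where
    field
      terminal     : Terminal
      products     : Products
      initial      : Initial
      coproducts   : Coproducts
      exponentials : Exponentials products

  record DistributiveStructure : Set (o ⊔ m ⊔ e) where
    field
      terminal   : Terminal
      products   : Products
      initial    : Initial
      coproducts : Coproducts
    open Products products
    open Coproducts coproducts

    distrib : ∀ {a b c} → Hom ((a × b) + (a × c)) (a × (b + c))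
    distrib = [ id ⁂ i₁ , id ⁂ i₂ ]

    field
      distrib⁻¹   : ∀ {a b c} → Hom (a × (b + c)) ((a × b) + (a × c))
      distrib-isoˡ : ∀ {a b c} → distrib⁻¹ ∘ distrib {a} {b} {c} ≈ id
      distrib-isoʳ : ∀ {a b c} → distrib {a} {b} {c} ∘ distrib⁻¹ ≈ id

-- [𝒞^op, Set]_× : presheaves (valued in setoids of level ℓ) sending the
-- finite coproducts of 𝒞 to finite products, with natural transformations.

module _ {o m e} (𝒞 : Category o m e) (D : DistributiveStructure 𝒞) (ℓ : Level) where
  open Category 𝒞
  open DistributiveStructure D using (initial; coproducts)
  open Initial initial
  open Coproducts coproducts

  record ProdPresheaf : Set (o ⊔ m ⊔ e ⊔ lsuc ℓ) where
    field
      F₀ : Obj → Setoid ℓ ℓ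
    ∣_∣ : Obj → Set ℓ
    ∣ a ∣ = Setoid.Carrier (F₀ a)
    _≈[_]_ : ∀ {a} → ∣ a ∣ → (a' : Obj) → ∣ a ∣ → Set ℓ
    _≈[_]_ {a} x _ y = Setoid._≈_ (F₀ a) x y
    field
      F₁        : ∀ {a b} → Hom a b → ∣ b ∣ → ∣ a ∣
      F₁-cong   : ∀ {a b} (f : Hom a b) {x y : ∣ b ∣} →
                  x ≈[ b ] y → F₁ f x ≈[ a ] F₁ f y
      F₁-resp-≈ : ∀ {a b} {f g : Hom a b} (x : ∣ b ∣) →
                  f ≈ g → F₁ f x ≈[ a ] F₁ g x
      F-id      : ∀ {a} (x : ∣ a ∣) → F₁ id x ≈[ a ] x
      F-∘       : ∀ {a b c} (f : Hom a b) (g : Hom b c) (x : ∣ c ∣) →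
                  F₁ (g ∘ f) x ≈[ a ] F₁ f (F₁ g x)
      F⊥-pt     : ∣ ⊥ ∣
      F⊥-contr  : (x : ∣ ⊥ ∣) → x ≈[ ⊥ ] F⊥-pt
      F+-surj   : ∀ {a b} (x : ∣ a ∣) (y : ∣ b ∣) →
                  Σ ∣ a + b ∣ (λ z → F₁ i₁ z ≈[ a ] x P.× F₁ i₂ z ≈[ b ] y)
      F+-inj    : ∀ {a b} (z z' : ∣ a + b ∣) →
                  F₁ i₁ z ≈[ a ] F₁ i₁ z' → F₁ i₂ z ≈[ b ] F₁ i₂ z' →
                  z ≈[ a + b ] z'

  open ProdPresheaf

  record NatTrans (F G : ProdPresheaf) : Set (o ⊔ m ⊔ ℓ) where
    field
      η       : ∀ a → ∣ F ∣ a → ∣ G ∣ a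
      η-cong  : ∀ a {x y : ∣ F ∣ a} → _≈[_]_ F x a y → _≈[_]_ G (η a x) a (η a y)
      natural : ∀ {a b} (f : Hom a b) (x : ∣ F ∣ b) →
                _≈[_]_ G (η a (F₁ F f x)) a (F₁ G f (η b x))
  open NatTrans

  PSh× : Category (o ⊔ m ⊔ e ⊔ lsuc ℓ) (o ⊔ m ⊔ ℓ) (o ⊔ ℓ)
  PSh× = record
    { Obj       = ProdPresheaf
    ; Hom       = NatTrans
    ; _≈_       = λ {F} {G} α β → ∀ a (x : ∣ F ∣ a) → _≈[_]_ G (η α a x) a (η β a x)
    ; ≈-equiv   = λ {F} {G} → record
        { refl  = λ a x → Setoid.refl (F₀ G a)
        ; sym   = λ p a x → Setoid.sym (F₀ G a) (p a x)
        ; trans = λ p q a x → Setoid.trans (F₀ G a) (p a x) (q a x) }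
    ; id        = λ {F} → record
        { η = λ a x → x ; η-cong = λ a p → p
        ; natural = λ f x → Setoid.refl (F₀ F _) }
    ; _∘_       = λ {F} {G} {H} β α → record
        { η = λ a x → η β a (η α a x)
        ; η-cong = λ a p → η-cong β a (η-cong α a p)
        ; natural = λ {a} f x → Setoid.trans (F₀ H a)
            (η-cong β a (natural α f x)) (natural β f (η α _ x)) }
    ; identityˡ = λ {F} {G} a x → Setoid.refl (F₀ G a)
    ; identityʳ = λ {F} {G} a x → Setoid.refl (F₀ G a)
    ; assoc     = λ {_} {_} {_} {H} a x → Setoid.refl (F₀ H a)
    ; ∘-resp-≈  = λ {_} {_} {H} {f} {f'} p q a x →
        Setoid.trans (F₀ H a) (η-cong f a (q a x)) (p a _)
    }

data Ty (Base : Set) : Set where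
  ι         : Base → Ty Base
  𝟙 𝟘       : Ty Base
  _⊗_ _⊕_ _⇛_ : Ty Base → Ty Base → Ty Base

data Ctx (Base : Set) : Set where
  ε   : Ctx Base
  _▸_ : Ctx Base → Ty Base → Ctx Base

module _ {Base : Set} where

  infix 3 _∋_
  data _∋_ : Ctx Base → Ty Base → Set where
    ze : ∀ {Γ A} → Γ ▸ A ∋ A
    su : ∀ {Γ A B} → Γ ∋ A → Γ ▸ B ∋ A

  data Tm (Γ : Ctx Base) : Ty Base → Set where
    var    : ∀ {A} → Γ ∋ A → Tm Γ A
    unit   : Tm Γ 𝟙
    pair   : ∀ {A B} → Tm Γ A → Tm Γ B → Tm Γ (A ⊗ B)
    fst    : ∀ {A B} → Tm Γ (A ⊗ B) → Tm Γ A
    snd    : ∀ {A B} → Tm Γ (A ⊗ B) → Tm Γ B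
    absurd : ∀ {C} → Tm Γ 𝟘 → Tm Γ C
    inl    : ∀ {A B} → Tm Γ A → Tm Γ (A ⊕ B)
    inr    : ∀ {A B} → Tm Γ B → Tm Γ (A ⊕ B)
    case   : ∀ {A B C} → Tm Γ (A ⊕ B) → Tm (Γ ▸ A) C → Tm (Γ ▸ B) C → Tm Γ C
    lam    : ∀ {A B} → Tm (Γ ▸ A) B → Tm Γ (A ⇛ B)
    app    : ∀ {A B} → Tm Γ (A ⇛ B) → Tm Γ A → Tm Γ B

  Ren Sub : Ctx Base → Ctx Base → Set
  Ren Γ Δ = ∀ {A} → Γ ∋ A → Δ ∋ A
  Sub Γ Δ = ∀ {A} → Γ ∋ A → Tm Δ A

  liftR : ∀ {Γ Δ B} → Ren Γ Δ → Ren (Γ ▸ B) (Δ ▸ B)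
  liftR r ze     = ze
  liftR r (su i) = su (r i)

  ren : ∀ {Γ Δ A} → Ren Γ Δ → Tm Γ A → Tm Δ A
  ren r (var i)      = var (r i)
  ren r unit         = unit
  ren r (pair M N)   = pair (ren r M) (ren r N)
  ren r (fst M)      = fst (ren r M)
  ren r (snd M)      = snd (ren r M)
  ren r (absurd M)   = absurd (ren r M)
  ren r (inl M)      = inl (ren r M)
  ren r (inr M)      = inr (ren r M)
  ren r (case M N O) = case (ren r M) (ren (liftR r) N) (ren (liftR r) O)
  ren r (lam M)      = lam (ren (liftR r) M)
  ren r (app M N)    = app (ren r M) (ren r N)

  wk : ∀ {Γ A B} → Tm Γ A → Tm (Γ ▸ B) A
  wk = ren su

  liftS : ∀ {Γ Δ B} → Sub Γ Δ → Sub (Γ ▸ B) (Δ ▸ B)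
  liftS s ze     = var ze
  liftS s (su i) = wk (s i)

  sub : ∀ {Γ Δ A} → Sub Γ Δ → Tm Γ A → Tm Δ A
  sub s (var i)      = s i
  sub s unit         = unit
  sub s (pair M N)   = pair (sub s M) (sub s N)
  sub s (fst M)      = fst (sub s M)
  sub s (snd M)      = snd (sub s M)
  sub s (absurd M)   = absurd (sub s M)
  sub s (inl M)      = inl (sub s M)
  sub s (inr M)      = inr (sub s M)
  sub s (case M N O) = case (sub s M) (sub (liftS s) N) (sub (liftS s) O)
  sub s (lam M)      = lam (sub (liftS s) M)
  sub s (app M N)    = app (sub s M) (sub s N)

  _,ₛ_ : ∀ {Γ Δ A} → Sub Γ Δ → Tm Δ A → Sub (Γ ▸ A) Δ
  (s ,ₛ N) ze     = N
  (s ,ₛ N) (su i) = s i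

  _[_] : ∀ {Γ A B} → Tm (Γ ▸ A) B → Tm Γ A → Tm Γ B
  M [ N ] = sub (var ,ₛ N) M

  infix 4 _≈βη_
  data _≈βη_ {Γ : Ctx Base} : ∀ {A} → Tm Γ A → Tm Γ A → Set where
    refl≈  : ∀ {A} {M : Tm Γ A} → M ≈βη M
    sym≈   : ∀ {A} {M N : Tm Γ A} → M ≈βη N → N ≈βη M
    trans≈ : ∀ {A} {M N O : Tm Γ A} → M ≈βη N → N ≈βη O → M ≈βη O
    pair-cong   : ∀ {A B} {M M' : Tm Γ A} {N N' : Tm Γ B} →
                  M ≈βη M' → N ≈βη N' → pair M N ≈βη pair M' N'
    fst-cong    : ∀ {A B} {M M' : Tm Γ (A ⊗ B)} → M ≈βη M' → fst M ≈βη fst M'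
    snd-cong    : ∀ {A B} {M M' : Tm Γ (A ⊗ B)} → M ≈βη M' → snd M ≈βη snd M'
    absurd-cong : ∀ {C} {M M' : Tm Γ 𝟘} → M ≈βη M' → absurd {C = C} M ≈βη absurd M'
    inl-cong    : ∀ {A B} {M M' : Tm Γ A} → M ≈βη M' → inl {B = B} M ≈βη inl M'
    inr-cong    : ∀ {A B} {M M' : Tm Γ B} → M ≈βη M' → inr {A = A} M ≈βη inr M'
    case-cong   : ∀ {A B C} {M M' : Tm Γ (A ⊕ B)} {N N' : Tm (Γ ▸ A) C}
                  {O O' : Tm (Γ ▸ B) C} →
                  M ≈βη M' → N ≈βη N' → O ≈βη O' → case M N O ≈βη case M' N' O'
    lam-cong    : ∀ {A B} {M M' : Tm (Γ ▸ A) B} → M ≈βη M' → lam M ≈βη lam M'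
    app-cong    : ∀ {A B} {M M' : Tm Γ (A ⇛ B)} {N N' : Tm Γ A} →
                  M ≈βη M' → N ≈βη N' → app M N ≈βη app M' N'
    𝟙-η   : (M : Tm Γ 𝟙) → M ≈βη unit
    ⊗-β₁  : ∀ {A B} (M : Tm Γ A) (N : Tm Γ B) → fst (pair M N) ≈βη M
    ⊗-β₂  : ∀ {A B} (M : Tm Γ A) (N : Tm Γ B) → snd (pair M N) ≈βη N
    ⊗-η   : ∀ {A B} (M : Tm Γ (A ⊗ B)) → pair (fst M) (snd M) ≈βη M
    𝟘-η   : ∀ {C} (M : Tm (Γ ▸ 𝟘) C) (N : Tm Γ 𝟘) → M [ N ] ≈βη absurd N
    ⊕-β₁  : ∀ {A B C} (M : Tm Γ A) (N : Tm (Γ ▸ A) C) (O : Tm (Γ ▸ B) C) →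
            case (inl M) N O ≈βη N [ M ]
    ⊕-β₂  : ∀ {A B C} (M : Tm Γ B) (N : Tm (Γ ▸ A) C) (O : Tm (Γ ▸ B) C) →
            case (inr M) N O ≈βη O [ M ]
    ⊕-η   : ∀ {A B C} (M : Tm (Γ ▸ (A ⊕ B)) C) (N : Tm Γ (A ⊕ B)) →
            M [ N ] ≈βη case N (sub ((λ i → var (su i)) ,ₛ inl (var ze)) M)
                               (sub ((λ i → var (su i)) ,ₛ inr (var ze)) M)
    ⇛-β   : ∀ {A B} (M : Tm (Γ ▸ A) B) (N : Tm Γ A) → app (lam M) N ≈βη M [ N ]
    ⇛-η   : ∀ {A B} (M : Tm Γ (A ⇛ B)) → lam (app (wk M) (var ze)) ≈βη M

module Interpretation {o m e} {Base : Set} (𝒞 : Category o m e)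
                      (S : BCCStructure 𝒞) (ρ : Base → Category.Obj 𝒞) where
  open Category 𝒞
  open BCCStructure S
  open Terminal terminal
  open Initial initial
  open Products products
  open Coproducts coproducts
  open Exponentials exponentials

  ⟦_⟧ty : Ty Base → Obj
  ⟦ ι b ⟧ty   = ρ b
  ⟦ 𝟙 ⟧ty     = ⊤
  ⟦ 𝟘 ⟧ty     = ⊥
  ⟦ A ⊗ B ⟧ty = ⟦ A ⟧ty × ⟦ B ⟧ty
  ⟦ A ⊕ B ⟧ty = ⟦ A ⟧ty + ⟦ B ⟧ty
  ⟦ A ⇛ B ⟧ty = ⟦ A ⟧ty ⇒ ⟦ B ⟧ty

  ⟦_⟧ctx : Ctx Base → Obj
  ⟦ ε ⟧ctx     = ⊤
  ⟦ Γ ▸ A ⟧ctx = ⟦ Γ ⟧ctx × ⟦ A ⟧ty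

  ⟦_⟧var : ∀ {Γ A} → Γ ∋ A → Hom ⟦ Γ ⟧ctx ⟦ A ⟧ty
  ⟦ ze ⟧var   = π₂
  ⟦ su i ⟧var = ⟦ i ⟧var ∘ π₁

  ⟦_⟧ : ∀ {Γ A} → Tm Γ A → Hom ⟦ Γ ⟧ctx ⟦ A ⟧ty
  ⟦ var i ⟧      = ⟦ i ⟧var
  ⟦ unit ⟧       = !
  ⟦ pair M N ⟧   = ⟨ ⟦ M ⟧ , ⟦ N ⟧ ⟩
  ⟦ fst M ⟧      = π₁ ∘ ⟦ M ⟧
  ⟦ snd M ⟧      = π₂ ∘ ⟦ M ⟧
  ⟦ absurd M ⟧   = eval ∘ ⟨ ¡ ∘ ⟦ M ⟧ , id ⟩
  ⟦ inl M ⟧      = i₁ ∘ ⟦ M ⟧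
  ⟦ inr M ⟧      = i₂ ∘ ⟦ M ⟧
  ⟦ case M N O ⟧ = eval ∘ ⟨ [ curry (⟦ N ⟧ ∘ ⟨ π₂ , π₁ ⟩)
                            , curry (⟦ O ⟧ ∘ ⟨ π₂ , π₁ ⟩) ] ∘ ⟦ M ⟧ , id ⟩
  ⟦ lam M ⟧      = curry ⟦ M ⟧
  ⟦ app M N ⟧    = eval ∘ ⟨ ⟦ M ⟧ , ⟦ N ⟧ ⟩

⟦_⟧⟨_,_⟩ : ∀ {o m e} {Base : Set} {𝒞 : Category o m e} {Γ : Ctx Base} {A : Ty Base} →
           Tm Γ A → (S : BCCStructure 𝒞) (ρ : Base → Category.Obj 𝒞) →
           Category.Hom 𝒞 (Interpretation.⟦_⟧ctx 𝒞 S ρ Γ) (Interpretation.⟦_⟧ty 𝒞 S ρ A)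
⟦_⟧⟨_,_⟩ {𝒞 = 𝒞} M S ρ = Interpretation.⟦_⟧ 𝒞 S ρ M

BCCComplete : (ℓ : Level) (Base : Set) → Set (lsuc ℓ)
BCCComplete ℓ Base =
  ∀ {Γ : Ctx Base} {A : Ty Base} (M N : Tm Γ A) →
  (∀ (𝒞 : Category ℓ ℓ ℓ) (S : BCCStructure 𝒞) (ρ : Base → Category.Obj 𝒞) →
     Category._≈_ 𝒞 ⟦ M ⟧⟨ S , ρ ⟩ ⟦ N ⟧⟨ S , ρ ⟩) →
  M ≈βη N

{-# OPTIONS --safe #-}

-- Every bicartesian closed category 𝒞 is distributive, [𝒞^op, Set]_× is
-- bicartesian closed, and the Yoneda embedding 𝒞 → [𝒞^op, Set]_× is faithful
-- and preserves the bicartesian closed structure up to isomorphism.  Hence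
-- terms identified in [𝒞^op, Set]_× are already identified in 𝒞, and
-- completeness applies.  Preservation is expressed as a logical relation: the
-- presheaf interpreting a type is represented by the object of 𝒞 interpreting
-- it, and under these representations ⟦ M ⟧ in presheaves is composition with
-- ⟦ M ⟧ in 𝒞.

module Submission where

open import Defs
open import Level using (Level; _⊔_) renaming (suc to lsuc)
open import Data.Product using (_,_; proj₁; proj₂)
open import Data.Product.Relation.Binary.Pointwise.NonDependent using (×-setoid)
open import Data.Unit.Polymorphic using (tt) renaming (⊤ to Unit)
open import Relation.Binary using (Setoid; IsEquivalence)
import Relation.Binary.Reasoning.Setoid as SetoidReasoning

-- The Yoneda embedding into all presheaves preserves products and exponentials but not coproducts.
-- Restricting to presheaves that turn coproducts into products repairs this and moves the work
-- elsewhere: coproducts are no longer pointwise, and the usual presheaf exponential must be shown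
-- to stay in the subcategory. Distributivity enters at the second point. A map `c → a + b` need not
-- split `c`, but `c × (a + b)` always splits, and every such map arises from the projection
-- `c × (a + b) → a + b` along its graph. The recurring device is therefore a universal argument:
-- families are compared at projections, maps out of representables at `id`.

-- Equational reasoning with products, coproducts and exponentials.

module HomReasoning {o m e} (𝒞 : Category o m e) where
  open Category 𝒞

  hom-setoid : ∀ {a b} → Setoid m e
  hom-setoid {a} {b} = record { isEquivalence = ≈-equiv {a} {b} }

  module _ {a b : Obj} where
    open IsEquivalence (≈-equiv {a} {b}) public using (refl; sym; trans)
    open SetoidReasoning (hom-setoid {a} {b}) public

  ∘-resp-≈ˡ : ∀ {a b c} {f f' : Hom b c} {g : Hom a b} → f ≈ f' → f ∘ g ≈ f' ∘ g
  ∘-resp-≈ˡ p = ∘-resp-≈ p refl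

  ∘-resp-≈ʳ : ∀ {a b c} {f : Hom b c} {g g' : Hom a b} → g ≈ g' → f ∘ g ≈ f ∘ g'
  ∘-resp-≈ʳ p = ∘-resp-≈ refl p

  pullˡ : ∀ {a b c d} {f : Hom c d} {g : Hom b c} {h : Hom b d} {k : Hom a b} →
          f ∘ g ≈ h → f ∘ (g ∘ k) ≈ h ∘ k
  pullˡ p = trans (sym assoc) (∘-resp-≈ˡ p)

  pullʳ : ∀ {a b c d} {f : Hom c d} {g : Hom b c} {k : Hom a b} {h : Hom a c} →
          g ∘ k ≈ h → (f ∘ g) ∘ k ≈ f ∘ h
  pullʳ p = trans assoc (∘-resp-≈ʳ p)

module ProductProperties {o m e} (𝒞 : Category o m e) (prod : Products 𝒞) where
  open Category 𝒞
  open HomReasoning 𝒞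
  open Products prod

  ⟨⟩-cong : ∀ {a b c} {f f' : Hom c a} {g g' : Hom c b} →
            f ≈ f' → g ≈ g' → ⟨ f , g ⟩ ≈ ⟨ f' , g' ⟩
  ⟨⟩-cong p q = ⟨⟩-unique _ (trans π₁-β p) (trans π₂-β q)

  ⟨⟩∘ : ∀ {a b c d} {f : Hom c a} {g : Hom c b} {h : Hom d c} →
        ⟨ f , g ⟩ ∘ h ≈ ⟨ f ∘ h , g ∘ h ⟩
  ⟨⟩∘ = ⟨⟩-unique _ (pullˡ π₁-β) (pullˡ π₂-β)

  ⁂∘⟨⟩ : ∀ {a b c d z} {f : Hom a c} {g : Hom b d} {h : Hom z a} {k : Hom z b} →
         (f ⁂ g) ∘ ⟨ h , k ⟩ ≈ ⟨ f ∘ h , g ∘ k ⟩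
  ⁂∘⟨⟩ = trans ⟨⟩∘ (⟨⟩-cong (pullʳ π₁-β) (pullʳ π₂-β))

  swap : ∀ {a b} → Hom (a × b) (b × a)
  swap = ⟨ π₂ , π₁ ⟩

  swap-⁂ : ∀ {a b c d} {f : Hom a c} {g : Hom b d} →
           swap ∘ (f ⁂ g) ≈ (g ⁂ f) ∘ swap
  swap-⁂ = trans ⟨⟩∘ (trans (⟨⟩-cong π₂-β π₁-β) (sym ⁂∘⟨⟩))

  ⁂-interchange : ∀ {a b c d} {f : Hom a c} {g : Hom b d} →
                  (f ⁂ id) ∘ (id ⁂ g) ≈ (id ⁂ g) ∘ (f ⁂ id)
  ⁂-interchange {f = f} {g} = begin
    (f ⁂ id) ∘ (id ⁂ g)                    ≈⟨ ⁂∘⟨⟩ ⟩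
    ⟨ f ∘ (id ∘ π₁) , id ∘ (g ∘ π₂) ⟩      ≈⟨ ⟨⟩-cong (∘-resp-≈ʳ identityˡ) identityˡ ⟩
    ⟨ f ∘ π₁ , g ∘ π₂ ⟩                    ≈⟨ ⟨⟩-cong identityˡ (∘-resp-≈ʳ identityˡ) ⟨
    ⟨ id ∘ (f ∘ π₁) , g ∘ (id ∘ π₂) ⟩      ≈⟨ ⁂∘⟨⟩ ⟨
    (id ⁂ g) ∘ (f ⁂ id)                    ∎

module CoproductProperties {o m e} (𝒞 : Category o m e) (coprod : Coproducts 𝒞) where
  open Category 𝒞
  open HomReasoning 𝒞
  open Coproducts coprod

  []-ext : ∀ {a b c} {h k : Hom (a + b) c} →
           h ∘ i₁ ≈ k ∘ i₁ → h ∘ i₂ ≈ k ∘ i₂ → h ≈ k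
  []-ext p q = trans ([]-unique _ p q) (sym ([]-unique _ refl refl))

module ExponentialProperties {o m e} (𝒞 : Category o m e) {prod : Products 𝒞}
                             (exp : Exponentials 𝒞 prod) where
  open Category 𝒞
  open HomReasoning 𝒞
  open Products prod
  open ProductProperties 𝒞 prod
  open Exponentials exp

  eval-curry : ∀ {a b c d} {f : Hom (a × b) c} {h : Hom d a} {k : Hom d b} →
               eval ∘ ⟨ curry f ∘ h , k ⟩ ≈ f ∘ ⟨ h , k ⟩
  eval-curry {f = f} {h} {k} = begin
    eval ∘ ⟨ curry f ∘ h , k ⟩          ≈⟨ ∘-resp-≈ʳ (⟨⟩-cong refl identityˡ) ⟨
    eval ∘ ⟨ curry f ∘ h , id ∘ k ⟩     ≈⟨ ∘-resp-≈ʳ ⁂∘⟨⟩ ⟨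
    eval ∘ ((curry f ⁂ id) ∘ ⟨ h , k ⟩) ≈⟨ pullˡ curry-β ⟩
    f ∘ ⟨ h , k ⟩                       ∎

  curry-∘ : ∀ {a b c d} {f : Hom (a × b) c} {g : Hom d a} →
            curry f ∘ g ≈ curry (f ∘ (g ⁂ id))
  curry-∘ {f = f} {g} = curry-unique _ (begin
    eval ∘ ⟨ (curry f ∘ g) ∘ π₁ , id ∘ π₂ ⟩ ≈⟨ ∘-resp-≈ʳ (⟨⟩-cong assoc refl) ⟩
    eval ∘ ⟨ curry f ∘ (g ∘ π₁) , id ∘ π₂ ⟩ ≈⟨ eval-curry ⟩
    f ∘ (g ⁂ id)                            ∎)

  curry-cong : ∀ {a b c} {f g : Hom (a × b) c} → f ≈ g → curry f ≈ curry g
  curry-cong p = curry-unique _ (trans curry-β p)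

module BCCOperations {o m e} (𝒞 : Category o m e) (S : BCCStructure 𝒞) where
  open Category 𝒞 public
  open BCCStructure S
  open Terminal terminal public
  open Initial initial public
  open Products products public
  open Coproducts coproducts public
  open Exponentials exponentials public

-- Distributivity from exponentials.

module BCCDistributive {o m e} (𝒞 : Category o m e) (S : BCCStructure 𝒞) where
  open BCCStructure S
  open BCCOperations 𝒞 S
  open HomReasoning 𝒞
  open ProductProperties 𝒞 products
  open CoproductProperties 𝒞 coproducts
  open ExponentialProperties 𝒞 exponentials

  -- `curry` keeps the first factor of a product and abstracts over the second. The swap makes it
  -- keep `b`, so `h` is encoded by a map out of `b` alone, and a coproduct in that position can be
  -- analysed through its injections.
  uncurry-swap : ∀ {a b z} (h : Hom (a × b) z) →
                 eval ∘ ⟨ curry (h ∘ swap) ∘ π₂ , π₁ ⟩ ≈ h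
  uncurry-swap h = begin
    eval ∘ ⟨ curry (h ∘ swap) ∘ π₂ , π₁ ⟩ ≈⟨ eval-curry ⟩
    (h ∘ swap) ∘ swap                     ≈⟨ pullʳ (trans ⟨⟩∘ (⟨⟩-cong π₂-β π₁-β)) ⟩
    h ∘ ⟨ π₁ , π₂ ⟩                       ≈⟨ ∘-resp-≈ʳ (⟨⟩-unique id identityʳ identityʳ) ⟨
    h ∘ id                                ≈⟨ identityʳ ⟩
    h                                     ∎

  -- Transposing h and k turns this into extensionality for maps out of b + c.
  ×-+-ext : ∀ {a b c z} {h k : Hom (a × (b + c)) z} →
            h ∘ (id ⁂ i₁) ≈ k ∘ (id ⁂ i₁) → h ∘ (id ⁂ i₂) ≈ k ∘ (id ⁂ i₂) → h ≈ k
  ×-+-ext {h = h} {k} p q = begin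
    h                                     ≈⟨ uncurry-swap h ⟨
    eval ∘ ⟨ curry (h ∘ swap) ∘ π₂ , π₁ ⟩ ≈⟨ ∘-resp-≈ʳ (⟨⟩-cong (∘-resp-≈ˡ ([]-ext (along p) (along q))) refl) ⟩
    eval ∘ ⟨ curry (k ∘ swap) ∘ π₂ , π₁ ⟩ ≈⟨ uncurry-swap k ⟩
    k                                     ∎
    where
    along : ∀ {d} {j : Hom d _} → h ∘ (id ⁂ j) ≈ k ∘ (id ⁂ j) →
            curry (h ∘ swap) ∘ j ≈ curry (k ∘ swap) ∘ j
    along {j = j} r = begin
      curry (h ∘ swap) ∘ j              ≈⟨ curry-∘ ⟩
      curry ((h ∘ swap) ∘ (j ⁂ id))     ≈⟨ curry-cong (pullʳ swap-⁂) ⟩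
      curry (h ∘ ((id ⁂ j) ∘ swap))     ≈⟨ curry-cong (trans (sym assoc) (trans (∘-resp-≈ˡ r) assoc)) ⟩
      curry (k ∘ ((id ⁂ j) ∘ swap))     ≈⟨ curry-cong (pullʳ swap-⁂) ⟨
      curry ((k ∘ swap) ∘ (j ⁂ id))     ≈⟨ curry-∘ ⟨
      curry (k ∘ swap) ∘ j              ∎

  undistrib : ∀ {a b c} → Hom (a × (b + c)) ((a × b) + (a × c))
  undistrib = eval ∘ ⟨ [ curry (i₁ ∘ swap) , curry (i₂ ∘ swap) ] ∘ π₂ , π₁ ⟩

  -- With `j` arbitrary, one computation serves both injections; the premise is then `i₁-β` or
  -- `i₂-β`.
  undistrib-∘ : ∀ {a b c d} {j : Hom d (b + c)} {k : Hom (a × d) ((a × b) + (a × c))} →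
                [ curry (i₁ ∘ swap) , curry (i₂ ∘ swap) ] ∘ j ≈ curry (k ∘ swap) →
                undistrib ∘ (id ⁂ j) ≈ k
  undistrib-∘ {j = j} {k} p = begin
    undistrib ∘ (id ⁂ j)                     ≈⟨ pullʳ ⟨⟩∘ ⟩
    eval ∘ ⟨ (u ∘ π₂) ∘ (id ⁂ j) , π₁ ∘ (id ⁂ j) ⟩
      ≈⟨ ∘-resp-≈ʳ (⟨⟩-cong (trans (pullʳ π₂-β) (pullˡ p)) (trans π₁-β identityˡ)) ⟩
    eval ∘ ⟨ curry (k ∘ swap) ∘ π₂ , π₁ ⟩    ≈⟨ uncurry-swap k ⟩
    k                                        ∎
    where u = [ curry (i₁ ∘ swap) , curry (i₂ ∘ swap) ]

  distributive : DistributiveStructure 𝒞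
  distributive = record
    { terminal     = terminal
    ; products     = products
    ; initial      = initial
    ; coproducts   = coproducts
    ; distrib⁻¹    = undistrib
    ; distrib-isoˡ = []-ext (trans (pullʳ i₁-β) (trans (undistrib-∘ i₁-β) (sym identityˡ)))
                            (trans (pullʳ i₂-β) (trans (undistrib-∘ i₂-β) (sym identityˡ)))
    ; distrib-isoʳ = ×-+-ext
        (trans (pullʳ (undistrib-∘ i₁-β)) (trans i₁-β (sym identityˡ)))
        (trans (pullʳ (undistrib-∘ i₂-β)) (trans i₂-β (sym identityˡ)))
    }

-- Consequences of distributivity; strictness of the initial object.

module DistributiveProperties {o m e} (𝒞 : Category o m e) (D : DistributiveStructure 𝒞) where
  open Category 𝒞
  open HomReasoning 𝒞
  open DistributiveStructure D
  open Initial initial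
  open Products products
  open ProductProperties 𝒞 products
  open Coproducts coproducts

  distrib⁻¹-i₁ : ∀ {a b c} → distrib⁻¹ ∘ (id ⁂ i₁) ≈ i₁ {a × b} {a × c}
  distrib⁻¹-i₁ = trans (∘-resp-≈ʳ (sym i₁-β)) (trans (pullˡ distrib-isoˡ) identityˡ)

  distrib⁻¹-i₂ : ∀ {a b c} → distrib⁻¹ ∘ (id ⁂ i₂) ≈ i₂ {a × b} {a × c}
  distrib⁻¹-i₂ = trans (∘-resp-≈ʳ (sym i₂-β)) (trans (pullˡ distrib-isoˡ) identityˡ)

  -- The two injections ⊥ → ⊥ + ⊥ agree, so by distributivity the two injections
  -- of a × ⊥ into (a × ⊥) + (a × ⊥) agree, and [ f , g ] identifies f and g.
  ×⊥-ext : ∀ {a z} (f g : Hom (a × ⊥) z) → f ≈ g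
  ×⊥-ext f g = begin
    f              ≈⟨ i₁-β ⟨
    [ f , g ] ∘ i₁ ≈⟨ ∘-resp-≈ʳ i₁≈i₂ ⟩
    [ f , g ] ∘ i₂ ≈⟨ i₂-β ⟩
    g              ∎
    where
    i₁≈i₂ : i₁ ≈ i₂
    i₁≈i₂ = begin
      i₁                      ≈⟨ distrib⁻¹-i₁ ⟨
      distrib⁻¹ ∘ (id ⁂ i₁)
        ≈⟨ ∘-resp-≈ʳ (⟨⟩-cong refl (∘-resp-≈ˡ (trans (¡-unique i₁) (sym (¡-unique i₂))))) ⟩
      distrib⁻¹ ∘ (id ⁂ i₂)   ≈⟨ distrib⁻¹-i₂ ⟩
      i₂                      ∎

  -- The graph `⟨ id , f ⟩` lands in `a × ⊥`, out of which all parallel maps agree; `¡ ∘ π₂` and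
  -- `π₁` are compared along it.
  strict-initial : ∀ {a} (f : Hom a ⊥) → ¡ ∘ f ≈ id
  strict-initial f = begin
    ¡ ∘ f                    ≈⟨ pullʳ π₂-β ⟨
    (¡ ∘ π₂) ∘ ⟨ id , f ⟩    ≈⟨ ∘-resp-≈ˡ (×⊥-ext _ _) ⟩
    π₁ ∘ ⟨ id , f ⟩          ≈⟨ π₁-β ⟩
    id                       ∎

-- Bicartesian closed structure on product-preserving presheaves.

module PresheafBCC {ℓ} (𝒞 : Category ℓ ℓ ℓ) (D : DistributiveStructure 𝒞) where
  open Category 𝒞
  open HomReasoning 𝒞 using (refl; sym; trans; ∘-resp-≈ˡ; ∘-resp-≈ʳ; hom-setoid)
  open DistributiveStructure D using (initial; products; coproducts; distrib⁻¹; distrib-isoʳ)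
  open DistributiveProperties 𝒞 D
  open Initial initial
  open Products products
  open ProductProperties 𝒞 products
  open Coproducts coproducts
  open CoproductProperties 𝒞 coproducts
  open ProdPresheaf
  open NatTrans

  Psh : Set _
  Psh = ProdPresheaf 𝒞 D ℓ

  _⟶_ : Psh → Psh → Set _
  _⟶_ = NatTrans 𝒞 D ℓ

  module _ (F : Psh) where
    private module F {a} = Setoid (F₀ F a)

    glue : ∀ {a b} → ∣ F ∣ a → ∣ F ∣ b → ∣ F ∣ (a + b)
    glue x y = proj₁ (F+-surj F x y)

    glue-β₁ : ∀ {a b} {x : ∣ F ∣ a} {y : ∣ F ∣ b} → F₁ F i₁ (glue x y) F.≈ x
    glue-β₁ = proj₁ (proj₂ (F+-surj F _ _))

    glue-β₂ : ∀ {a b} {x : ∣ F ∣ a} {y : ∣ F ∣ b} → F₁ F i₂ (glue x y) F.≈ y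
    glue-β₂ = proj₂ (proj₂ (F+-surj F _ _))

    glue-unique : ∀ {a b} {x : ∣ F ∣ a} {y : ∣ F ∣ b} (z : ∣ F ∣ (a + b)) →
                  F₁ F i₁ z F.≈ x → F₁ F i₂ z F.≈ y → z F.≈ glue x y
    glue-unique z p q =
      F+-inj F _ _ (F.trans p (F.sym glue-β₁)) (F.trans q (F.sym glue-β₂))

    F₁-square : ∀ {a b b' c} {f : Hom a b} {g : Hom b c} {f' : Hom a b'} {g' : Hom b' c} →
                g ∘ f ≈ g' ∘ f' → (x : ∣ F ∣ c) →
                F₁ F f (F₁ F g x) F.≈ F₁ F f' (F₁ F g' x)
    F₁-square p x =
      F.trans (F.sym (F-∘ F _ _ x)) (F.trans (F₁-resp-≈ F x p) (F-∘ F _ _ x))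

    -- Distributivity makes the comparison
    -- ∣ F ∣ (c × (a + b)) → ∣ F ∣ (c × a) × ∣ F ∣ (c × b) bijective too.
    distrib-glue : ∀ {a b c} → ∣ F ∣ (c × a) → ∣ F ∣ (c × b) → ∣ F ∣ (c × (a + b))
    distrib-glue x y = F₁ F distrib⁻¹ (glue x y)

    distrib-glue-β₁ : ∀ {a b c} {x : ∣ F ∣ (c × a)} {y : ∣ F ∣ (c × b)} →
                      F₁ F (id ⁂ i₁) (distrib-glue x y) F.≈ x
    distrib-glue-β₁ = F.trans (F.sym (F-∘ F _ _ _))
      (F.trans (F₁-resp-≈ F _ distrib⁻¹-i₁) glue-β₁)

    distrib-glue-β₂ : ∀ {a b c} {x : ∣ F ∣ (c × a)} {y : ∣ F ∣ (c × b)} →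
                      F₁ F (id ⁂ i₂) (distrib-glue x y) F.≈ y
    distrib-glue-β₂ = F.trans (F.sym (F-∘ F _ _ _))
      (F.trans (F₁-resp-≈ F _ distrib⁻¹-i₂) glue-β₂)

    -- Restriction along `distrib` is injective because `distrib ∘ distrib⁻¹ ≈ id`, and the
    -- restricted elements lie over a coproduct, where `F+-inj` compares them summand by summand.
    distrib-ext : ∀ {a b c} {z z' : ∣ F ∣ (c × (a + b))} →
                  F₁ F (id ⁂ i₁) z F.≈ F₁ F (id ⁂ i₁) z' →
                  F₁ F (id ⁂ i₂) z F.≈ F₁ F (id ⁂ i₂) z' → z F.≈ z'
    distrib-ext {z = z} {z'} p q = F.trans (F.sym (restrict-distrib z))
      (F.trans (F₁-cong F distrib⁻¹ (F+-inj F _ _ (along i₁-β p) (along i₂-β q)))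
               (restrict-distrib z'))
      where
      open DistributiveStructure D using (distrib)

      restrict-distrib : ∀ z → F₁ F distrib⁻¹ (F₁ F distrib z) F.≈ z
      restrict-distrib z = F.trans (F.sym (F-∘ F _ _ z))
        (F.trans (F₁-resp-≈ F z distrib-isoʳ) (F-id F z))

      along : ∀ {d} {i : Hom d _} {j : Hom d _} → distrib ∘ i ≈ j → F₁ F j z F.≈ F₁ F j z' →
              F₁ F i (F₁ F distrib z) F.≈ F₁ F i (F₁ F distrib z')
      along r s = F.trans (F.sym (F-∘ F _ _ z)) (F.trans (F₁-resp-≈ F z r)
        (F.trans s (F.trans (F.sym (F₁-resp-≈ F z' r)) (F-∘ F _ _ z'))))

  -- Representables qualify because the universal properties of `⊥` and `+` say exactly that the
  -- maps out of them into `a` form a one-point set and a product.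
  y : Obj → Psh
  y a = record
    { F₀        = λ c → hom-setoid {c} {a}
    ; F₁        = λ f h → h ∘ f
    ; F₁-cong   = λ f → ∘-resp-≈ˡ
    ; F₁-resp-≈ = λ h → ∘-resp-≈ʳ
    ; F-id      = λ h → identityʳ
    ; F-∘       = λ f g h → sym assoc
    ; F⊥-pt     = ¡
    ; F⊥-contr  = ¡-unique
    ; F+-surj   = λ f g → [ f , g ] , i₁-β , i₂-β
    ; F+-inj    = λ h k → []-ext
    }

  terminalᴾ : Terminal (PSh× 𝒞 D ℓ)
  terminalᴾ = record
    { ⊤ = record
      { F₀        = λ _ → record { Carrier = Unit ; _≈_ = λ _ _ → Unit ; isEquivalence = _ }
      ; F₁        = λ _ _ → tt
      ; F₁-cong   = λ _ _ → tt
      ; F₁-resp-≈ = λ _ _ → tt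
      ; F-id      = λ _ → tt
      ; F-∘       = λ _ _ _ → tt
      ; F⊥-pt     = tt
      ; F⊥-contr  = λ _ → tt
      ; F+-surj   = λ _ _ → tt , tt , tt
      ; F+-inj    = λ _ _ _ _ → tt
      }
    ; !        = record { η = λ _ _ → tt ; η-cong = λ _ _ → tt ; natural = λ _ _ → tt }
    ; !-unique = λ _ _ _ → tt
    }

  -- By Yoneda, `α` is determined by its value at `id`, an element of the one-point set over `⊥`.
  y⊥-unique : ∀ {F} (α : y ⊥ ⟶ F) c (h : Hom c ⊥) →
              Setoid._≈_ (F₀ F c) (η α c h) (F₁ F h (F⊥-pt F))
  y⊥-unique {F} α c h = begin
    η α c h           ≈⟨ η-cong α c (trans (sym identityˡ) (∘-resp-≈ˡ (trans (¡-unique id) (sym (¡-unique id))))) ⟩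
    η α c (id ∘ h)    ≈⟨ natural α h id ⟩
    F₁ F h (η α ⊥ id) ≈⟨ F₁-cong F h (F⊥-contr F _) ⟩
    F₁ F h (F⊥-pt F)  ∎
    where open SetoidReasoning (F₀ F c)

  -- The empty presheaf is excluded, since its value at `⊥` is not a point; the representable at `⊥`
  -- takes its place.
  initialᴾ : Initial (PSh× 𝒞 D ℓ)
  initialᴾ = record
    { ⊥ = y ⊥
    ; ¡ = λ {F} → record
      { η       = λ c h → F₁ F h (F⊥-pt F)
      ; η-cong  = λ c p → F₁-resp-≈ F (F⊥-pt F) p
      ; natural = λ f h → F-∘ F f h (F⊥-pt F)
      }
    ; ¡-unique = y⊥-unique
    }

  productsᴾ : Products (PSh× 𝒞 D ℓ)
  productsᴾ = record
    { _×_ = λ F G → record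
      { F₀        = λ c → ×-setoid (F₀ F c) (F₀ G c)
      ; F₁        = λ f (u , v) → F₁ F f u , F₁ G f v
      ; F₁-cong   = λ f (p , q) → F₁-cong F f p , F₁-cong G f q
      ; F₁-resp-≈ = λ (u , v) p → F₁-resp-≈ F u p , F₁-resp-≈ G v p
      ; F-id      = λ (u , v) → F-id F u , F-id G v
      ; F-∘       = λ f g (u , v) → F-∘ F f g u , F-∘ G f g v
      ; F⊥-pt     = F⊥-pt F , F⊥-pt G
      ; F⊥-contr  = λ (u , v) → F⊥-contr F u , F⊥-contr G v
      ; F+-surj   = λ (u , v) (u' , v') →
          (glue F u u' , glue G v v') ,
          (glue-β₁ F , glue-β₁ G) , (glue-β₂ F , glue-β₂ G)
      ; F+-inj    = λ _ _ (p , p') (q , q') → F+-inj F _ _ p q , F+-inj G _ _ p' q'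
      }
    ; π₁ = λ {F} → record
      { η = λ _ → proj₁ ; η-cong = λ _ → proj₁ ; natural = λ _ _ → Setoid.refl (F₀ F _) }
    ; π₂ = λ {_} {G} → record
      { η = λ _ → proj₂ ; η-cong = λ _ → proj₂ ; natural = λ _ _ → Setoid.refl (F₀ G _) }
    ; ⟨_,_⟩ = λ α β → record
      { η       = λ c u → η α c u , η β c u
      ; η-cong  = λ c p → η-cong α c p , η-cong β c p
      ; natural = λ f u → natural α f u , natural β f u
      }
    ; π₁-β      = λ {F} _ _ → Setoid.refl (F₀ F _)
    ; π₂-β      = λ {_} {G} _ _ → Setoid.refl (F₀ G _)
    ; ⟨⟩-unique = λ _ p q c u → p c u , q c u
    }

  -- Coproducts are not pointwise: 𝒞 is not assumed extensive, so the coproduct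
  -- is the product-preserving presheaf generated freely by F and G.
  module _ (F G : Psh) where
    data Free : Obj → Set ℓ where
      inj₁  : ∀ {a} → ∣ F ∣ a → Free a
      inj₂  : ∀ {a} → ∣ G ∣ a → Free a
      act   : ∀ {a b} → Hom a b → Free b → Free a
      point : Free ⊥
      join  : ∀ {a b} → Free a → Free b → Free (a + b)

    infix 4 _∼_
    -- Congruence of `join` is not listed because it follows: `join-ext` reduces it to the two β
    -- rules.
    data _∼_ : ∀ {a} → Free a → Free a → Set ℓ where
      ∼-refl       : ∀ {a} {s : Free a} → s ∼ s
      ∼-sym        : ∀ {a} {s t : Free a} → s ∼ t → t ∼ s
      ∼-trans      : ∀ {a} {s t u : Free a} → s ∼ t → t ∼ u → s ∼ u
      inj₁-cong    : ∀ {a} {u v : ∣ F ∣ a} → Setoid._≈_ (F₀ F a) u v → inj₁ u ∼ inj₁ v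
      inj₂-cong    : ∀ {a} {u v : ∣ G ∣ a} → Setoid._≈_ (F₀ G a) u v → inj₂ u ∼ inj₂ v
      inj₁-natural : ∀ {a b} (f : Hom a b) (u : ∣ F ∣ b) → inj₁ (F₁ F f u) ∼ act f (inj₁ u)
      inj₂-natural : ∀ {a b} (f : Hom a b) (u : ∣ G ∣ b) → inj₂ (F₁ G f u) ∼ act f (inj₂ u)
      act-cong     : ∀ {a b} (f : Hom a b) {s t : Free b} → s ∼ t → act f s ∼ act f t
      act-resp-≈   : ∀ {a b} {f g : Hom a b} (s : Free b) → f ≈ g → act f s ∼ act g s
      act-id       : ∀ {a} (s : Free a) → act id s ∼ s
      act-∘        : ∀ {a b c} (f : Hom a b) (g : Hom b c) (s : Free c) →
                     act (g ∘ f) s ∼ act f (act g s)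
      point-contr  : (s : Free ⊥) → s ∼ point
      join-β₁      : ∀ {a b} (s : Free a) (t : Free b) → act i₁ (join s t) ∼ s
      join-β₂      : ∀ {a b} (s : Free a) (t : Free b) → act i₂ (join s t) ∼ t
      join-ext     : ∀ {a b} (s t : Free (a + b)) →
                     act i₁ s ∼ act i₁ t → act i₂ s ∼ act i₂ t → s ∼ t

    _+ᴾ_ : Psh
    _+ᴾ_ = record
      { F₀        = λ a → record
        { Carrier       = Free a
        ; _≈_           = _∼_
        ; isEquivalence = record { refl = ∼-refl ; sym = ∼-sym ; trans = ∼-trans }
        }
      ; F₁        = act
      ; F₁-cong   = act-cong
      ; F₁-resp-≈ = act-resp-≈
      ; F-id      = act-id
      ; F-∘       = act-∘
      ; F⊥-pt     = point
      ; F⊥-contr  = point-contr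
      ; F+-surj   = λ s t → join s t , join-β₁ s t , join-β₂ s t
      ; F+-inj    = join-ext
      }

  module _ {F G H : Psh} (α : F ⟶ H) (β : G ⟶ H) where
    private module H {a} = Setoid (F₀ H a)

    extend : ∀ {a} → Free F G a → ∣ H ∣ a
    extend (inj₁ u)   = η α _ u
    extend (inj₂ u)   = η β _ u
    extend (act f s)  = F₁ H f (extend s)
    extend point      = F⊥-pt H
    extend (join s t) = glue H (extend s) (extend t)

    extend-cong : ∀ {a} {s t : Free F G a} → _∼_ F G s t → extend s H.≈ extend t
    extend-cong ∼-refl             = H.refl
    extend-cong (∼-sym p)          = H.sym (extend-cong p)
    extend-cong (∼-trans p q)      = H.trans (extend-cong p) (extend-cong q)
    extend-cong (inj₁-cong p)      = η-cong α _ p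
    extend-cong (inj₂-cong p)      = η-cong β _ p
    extend-cong (inj₁-natural f u) = natural α f u
    extend-cong (inj₂-natural f u) = natural β f u
    extend-cong (act-cong f p)     = F₁-cong H f (extend-cong p)
    extend-cong (act-resp-≈ s p)   = F₁-resp-≈ H _ p
    extend-cong (act-id s)         = F-id H _
    extend-cong (act-∘ f g s)      = F-∘ H f g _
    extend-cong (point-contr s)    = F⊥-contr H _
    extend-cong (join-β₁ s t)      = glue-β₁ H
    extend-cong (join-β₂ s t)      = glue-β₂ H
    extend-cong (join-ext s t p q) = F+-inj H _ _ (extend-cong p) (extend-cong q)

    [_,_]ᴾ : (F +ᴾ G) ⟶ H
    [_,_]ᴾ = record
      { η = λ _ → extend ; η-cong = λ _ → extend-cong ; natural = λ _ _ → H.refl }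

    -- Nothing says that `γ` preserves `point` and `join`, but naturality forces it: the value over
    -- `⊥` is unique, and a value over a coproduct is determined by its restrictions along `i₁` and
    -- `i₂`, which the β rules compute.
    extend-unique : (γ : (F +ᴾ G) ⟶ H) →
                    (∀ a u → η γ a (inj₁ u) H.≈ η α a u) →
                    (∀ a u → η γ a (inj₂ u) H.≈ η β a u) →
                    ∀ a (s : Free F G a) → η γ a s H.≈ extend s
    extend-unique γ p q a (inj₁ u)   = p a u
    extend-unique γ p q a (inj₂ u)   = q a u
    extend-unique γ p q a (act f s)  =
      H.trans (natural γ f s) (F₁-cong H f (extend-unique γ p q _ s))
    extend-unique γ p q _ point      = F⊥-contr H _
    extend-unique γ p q _ (join s t) = glue-unique H _
      (H.trans (H.sym (natural γ i₁ _))
        (H.trans (η-cong γ _ (join-β₁ s t)) (extend-unique γ p q _ s)))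
      (H.trans (H.sym (natural γ i₂ _))
        (H.trans (η-cong γ _ (join-β₂ s t)) (extend-unique γ p q _ t)))

  coproductsᴾ : Coproducts (PSh× 𝒞 D ℓ)
  coproductsᴾ = record
    { _+_       = _+ᴾ_
    ; i₁        = record { η = λ _ → inj₁ ; η-cong = λ _ → inj₁-cong ; natural = inj₁-natural }
    ; i₂        = record { η = λ _ → inj₂ ; η-cong = λ _ → inj₂-cong ; natural = inj₂-natural }
    ; [_,_]     = [_,_]ᴾ
    ; i₁-β      = λ {_} {_} {H} _ _ → Setoid.refl (F₀ H _)
    ; i₂-β      = λ {_} {_} {H} _ _ → Setoid.refl (F₀ H _)
    ; []-unique = λ {_} {_} {_} {α} {β} → extend-unique α β
    }

  -- By Yoneda, the exponential at a consists of the natural transformations y a × F ⟶ G.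
  module _ (F G : Psh) where
    private
      module F {a} = Setoid (F₀ F a)
      module G {a} = Setoid (F₀ G a)

    record Family (a : Obj) : Set ℓ where
      field
        at         : ∀ {c} → Hom c a → ∣ F ∣ c → ∣ G ∣ c
        at-cong    : ∀ {c} {f f' : Hom c a} {u u' : ∣ F ∣ c} →
                     f ≈ f' → u F.≈ u' → at f u G.≈ at f' u'
        at-natural : ∀ {c d} (g : Hom d c) (f : Hom c a) (u : ∣ F ∣ c) →
                     at (f ∘ g) (F₁ F g u) G.≈ F₁ G g (at f u)

    open Family

    restrict : ∀ {a b} → Hom a b → Family b → Family a
    restrict f φ = record
      { at         = λ g u → at φ (f ∘ g) u
      ; at-cong    = λ p q → at-cong φ (∘-resp-≈ʳ p) q
      ; at-natural = λ h g u → G.trans (at-cong φ (sym assoc) F.refl) (at-natural φ h (f ∘ g) u)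
      }

    -- The value at the universal argument: `c × a` carries the universal pair of a map to `a` and a
    -- map to `c`. Every other value of the family at a restriction of `u` is a restriction of this
    -- one, by `at-graph`.
    generic : ∀ {a c} → Family a → ∣ F ∣ c → ∣ G ∣ (c × a)
    generic φ u = at φ π₂ (F₁ F π₁ u)

    at-graph : ∀ {a b c} (φ : Family a) {f : Hom b a} {g : Hom b c} {k : Hom b (c × a)} →
               π₁ ∘ k ≈ g → π₂ ∘ k ≈ f → (u : ∣ F ∣ c) →
               F₁ G k (generic φ u) G.≈ at φ f (F₁ F g u)
    at-graph φ p q u = G.trans (G.sym (at-natural φ _ π₂ _))
      (at-cong φ q (F.trans (F.sym (F-∘ F _ _ u)) (F₁-resp-≈ F u p)))

    generic-graph : ∀ {a c} (φ : Family a) (f : Hom c a) (u : ∣ F ∣ c) →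
                    F₁ G ⟨ id , f ⟩ (generic φ u) G.≈ at φ f u
    generic-graph φ f u = G.trans (at-graph φ π₁-β π₂-β u) (at-cong φ refl (F-id F u))

    generic-⁂ : ∀ {a b c} (φ : Family b) (j : Hom a b) (u : ∣ F ∣ c) →
                F₁ G (id ⁂ j) (generic φ u) G.≈ generic (restrict j φ) u
    generic-⁂ φ j u = at-graph φ (trans π₁-β identityˡ) π₂-β u

    generic-natural : ∀ {a c d} (φ : Family a) (g : Hom d c) (u : ∣ F ∣ c) →
                      F₁ G (g ⁂ id) (generic φ u) G.≈ generic φ (F₁ F g u)
    generic-natural φ g u = G.trans (at-graph φ π₁-β (trans π₂-β identityˡ) u)
      (at-cong φ refl (F-∘ F _ _ u))

    -- A map c → a + b need not decompose c, so a family at a + b is glued at its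
    -- generic argument π₂ : c × (a + b) → a + b and pulled back along the graph.
    module _ {a b} (φ : Family a) (ψ : Family b) where
      joined : ∀ {c} → ∣ F ∣ c → ∣ G ∣ (c × (a + b))
      joined u = distrib-glue G (generic φ u) (generic ψ u)

      joined-cong : ∀ {c} {u v : ∣ F ∣ c} → u F.≈ v → joined u G.≈ joined v
      joined-cong p = distrib-ext G
        (G.trans (distrib-glue-β₁ G) (G.trans (at-cong φ refl (F₁-cong F _ p)) (G.sym (distrib-glue-β₁ G))))
        (G.trans (distrib-glue-β₂ G) (G.trans (at-cong ψ refl (F₁-cong F _ p)) (G.sym (distrib-glue-β₂ G))))

      joined-natural : ∀ {c d} (g : Hom d c) (u : ∣ F ∣ c) →
                       F₁ G (g ⁂ id) (joined u) G.≈ joined (F₁ F g u)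
      joined-natural g u = distrib-ext G
        (G.trans (F₁-square G ⁂-interchange _)
          (G.trans (F₁-cong G _ (distrib-glue-β₁ G))
            (G.trans (generic-natural φ g u) (G.sym (distrib-glue-β₁ G)))))
        (G.trans (F₁-square G ⁂-interchange _)
          (G.trans (F₁-cong G _ (distrib-glue-β₂ G))
            (G.trans (generic-natural ψ g u) (G.sym (distrib-glue-β₂ G)))))

      join-family : Family (a + b)
      join-family = record
        { at         = λ f u → F₁ G ⟨ id , f ⟩ (joined u)
        ; at-cong    = λ p q → G.trans (F₁-resp-≈ G _ (⟨⟩-cong refl p)) (F₁-cong G _ (joined-cong q))
        ; at-natural = λ g f u → G.trans (F₁-cong G _ (G.sym (joined-natural g u)))
            -- Both `(g ⁂ id) ∘ ⟨ id , f ∘ g ⟩` and `⟨ id , f ⟩ ∘ g` are the pairing of `g` and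
            -- `f ∘ g`.
            (F₁-square G (trans ⁂∘⟨⟩ (trans (⟨⟩-cong (trans identityʳ (sym identityˡ)) identityˡ) (sym ⟨⟩∘))) _)
        }

      -- The graph of `j ∘ f` factors as `(id ⁂ j) ∘ ⟨ id , f ⟩`, so only the restriction of
      -- `joined u` to one summand matters.
      join-family-along : ∀ {c d} (χ : Family d) {j : Hom d (a + b)} →
                          (∀ {c} (u : ∣ F ∣ c) → F₁ G (id ⁂ j) (joined u) G.≈ generic χ u) →
                          (f : Hom c d) (u : ∣ F ∣ c) → at join-family (j ∘ f) u G.≈ at χ f u
      join-family-along χ p f u =
        G.trans (F₁-resp-≈ G _ (trans (⟨⟩-cong (sym identityˡ) refl) (sym ⁂∘⟨⟩)))
          (G.trans (F-∘ G _ _ _) (G.trans (F₁-cong G _ (p u)) (generic-graph χ f u)))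

    -- The hypotheses speak only of maps factoring through an injection, which `f` need not do. They
    -- do apply to the generic values, whose restrictions to the two summands are values at
    -- `i₁ ∘ π₂` and `i₂ ∘ π₂`; restriction along the graph of `f` finishes.
    family-ext : ∀ {a b} (φ ψ : Family (a + b)) →
                 (∀ {c} (f : Hom c a) (u : ∣ F ∣ c) → at φ (i₁ ∘ f) u G.≈ at ψ (i₁ ∘ f) u) →
                 (∀ {c} (f : Hom c b) (u : ∣ F ∣ c) → at φ (i₂ ∘ f) u G.≈ at ψ (i₂ ∘ f) u) →
                 ∀ {c} (f : Hom c (a + b)) (u : ∣ F ∣ c) → at φ f u G.≈ at ψ f u
    family-ext φ ψ p q f u =
      G.trans (G.sym (generic-graph φ f u))
        (G.trans (F₁-cong G _ (distrib-ext G
          (G.trans (generic-⁂ φ i₁ u) (G.trans (p _ _) (G.sym (generic-⁂ ψ i₁ u))))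
          (G.trans (generic-⁂ φ i₂ u) (G.trans (q _ _) (G.sym (generic-⁂ ψ i₂ u))))))
        (generic-graph ψ f u))

    -- A map `c → ⊥` makes `c` a retract of `⊥`, hence the value of `G` at `c` a retract of a point.
    strict : ∀ {c} → Hom c ⊥ → (u v : ∣ G ∣ c) → u G.≈ v
    strict f u v = G.trans (to-point u) (G.sym (to-point v))
      where
      to-point : ∀ u → u G.≈ F₁ G f (F⊥-pt G)
      to-point u = G.trans (G.sym (F-id G u)) (G.trans (F₁-resp-≈ G u (sym (strict-initial f)))
        (G.trans (F-∘ G f ¡ u) (F₁-cong G f (F⊥-contr G _))))

    _⇒ᴾ_ : Psh
    _⇒ᴾ_ = record
      { F₀        = λ a → record
        { Carrier       = Family a
        ; _≈_           = λ φ ψ → ∀ {c} (f : Hom c a) (u : ∣ F ∣ c) → at φ f u G.≈ at ψ f u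
        ; isEquivalence = record
          { refl  = λ f u → G.refl
          ; sym   = λ p f u → G.sym (p f u)
          ; trans = λ p q f u → G.trans (p f u) (q f u)
          }
        }
      ; F₁        = restrict
      ; F₁-cong   = λ f p g u → p (f ∘ g) u
      ; F₁-resp-≈ = λ φ p g u → at-cong φ (∘-resp-≈ˡ p) F.refl
      ; F-id      = λ φ g u → at-cong φ identityˡ F.refl
      ; F-∘       = λ f g φ h u → at-cong φ assoc F.refl
      ; F⊥-pt     = record
        { at         = λ f u → F₁ G f (F⊥-pt G)
        ; at-cong    = λ p q → F₁-resp-≈ G _ p
        ; at-natural = λ g f u → F-∘ G g f _
        }
      ; F⊥-contr  = λ φ f u → strict f _ _
      ; F+-surj   = λ φ ψ → join-family φ ψ
                          , join-family-along φ ψ φ (λ u → distrib-glue-β₁ G)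
                          , join-family-along φ ψ ψ (λ u → distrib-glue-β₂ G)
      ; F+-inj    = family-ext
      }

  open Family

  exponentialsᴾ : Exponentials (PSh× 𝒞 D ℓ) productsᴾ
  exponentialsᴾ = record
    { _⇒_  = _⇒ᴾ_
    ; eval = λ {F} {G} → record
      { η       = λ c (φ , u) → at φ id u
      ; η-cong  = λ c {(φ , u)} {(ψ , v)} (p , q) →
          Setoid.trans (F₀ G c) (p id u) (at-cong ψ refl q)
      ; natural = λ f (φ , u) → Setoid.trans (F₀ G _)
          (at-cong φ (trans identityʳ (sym identityˡ)) (Setoid.refl (F₀ F _))) (at-natural φ f id u)
      }
    ; curry = λ {H} {F} {G} α → record
      { η       = λ c w → record
        { at         = λ f u → η α _ (F₁ H f w , u)
        ; at-cong    = λ p q → η-cong α _ (F₁-resp-≈ H w p , q)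
        ; at-natural = λ g f u → Setoid.trans (F₀ G _)
            (η-cong α _ (F-∘ H g f w , Setoid.refl (F₀ F _))) (natural α g (F₁ H f w , u))
        }
      ; η-cong  = λ c p f u → η-cong α _ (F₁-cong H f p , Setoid.refl (F₀ F _))
      ; natural = λ f w g u → η-cong α _ (Setoid.sym (F₀ H _) (F-∘ H g f w) , Setoid.refl (F₀ F _))
      }
    ; curry-β = λ {H} {F} {G} {α} c (w , u) → η-cong α c (F-id H w , Setoid.refl (F₀ F c))
    -- Evaluation sees a family only at `id`. Naturality of `β` trades the value at `f` for the
    -- value at `id` of the family assigned to `w` restricted along `f`.
    ; curry-unique = λ {H} {F} {G} {α} β p c w f u → Setoid.trans (F₀ G _)
        (at-cong (η β c w) (sym identityʳ) (Setoid.refl (F₀ F _)))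
        (Setoid.trans (F₀ G _) (Setoid.sym (F₀ G _) (natural β f w id u)) (p _ (F₁ H f w , u)))
    }

  bcc : BCCStructure (PSh× 𝒞 D ℓ)
  bcc = record
    { terminal     = terminalᴾ
    ; products     = productsᴾ
    ; initial      = initialᴾ
    ; coproducts   = coproductsᴾ
    ; exponentials = exponentialsᴾ
    }

-- Logical relations between two bicartesian closed categories.

module _ {o m e o' m' e'} (𝒞 : Category o m e) (S : BCCStructure 𝒞)
         (𝒟 : Category o' m' e') (T : BCCStructure 𝒟) where
  private
    module C = BCCOperations 𝒞 S
    module D = BCCOperations 𝒟 T

  -- Proof-relevant: `Rel` may carry chosen data, such as an isomorphism. Only closure under the
  -- operations that occur in the interpretation is asked for, and no equations.
  record LogicalRelation (r s : Level) : Set (o ⊔ m ⊔ o' ⊔ m' ⊔ lsuc (r ⊔ s)) where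
    field
      Rel    : C.Obj → D.Obj → Set r
      Square : ∀ {a b x y} → Rel a x → Rel b y → C.Hom a b → D.Hom x y → Set s

      rel-⊤ : Rel C.⊤ D.⊤
      rel-⊥ : Rel C.⊥ D.⊥
      rel-× : ∀ {a b x y} → Rel a x → Rel b y → Rel (a C.× b) (x D.× y)
      rel-+ : ∀ {a b x y} → Rel a x → Rel b y → Rel (a C.+ b) (x D.+ y)
      rel-⇒ : ∀ {a b x y} → Rel a x → Rel b y → Rel (a C.⇒ b) (x D.⇒ y)

      sq-id    : ∀ {a x} {R : Rel a x} → Square R R C.id D.id
      sq-∘     : ∀ {a b c x y z} {R : Rel a x} {Q : Rel b y} {P : Rel c z} {f g α β} →
                 Square Q P g β → Square R Q f α → Square R P (g C.∘ f) (β D.∘ α)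
      sq-!     : ∀ {a x} {R : Rel a x} → Square R rel-⊤ C.! D.!
      sq-¡     : ∀ {a x} {R : Rel a x} → Square rel-⊥ R C.¡ D.¡
      sq-π₁    : ∀ {a b x y} {R : Rel a x} {Q : Rel b y} → Square (rel-× R Q) R C.π₁ D.π₁
      sq-π₂    : ∀ {a b x y} {R : Rel a x} {Q : Rel b y} → Square (rel-× R Q) Q C.π₂ D.π₂
      sq-⟨⟩    : ∀ {a b c x y z} {R : Rel a x} {Q : Rel b y} {P : Rel c z} {f g α β} →
                 Square R Q f α → Square R P g β →
                 Square R (rel-× Q P) C.⟨ f , g ⟩ D.⟨ α , β ⟩
      sq-i₁    : ∀ {a b x y} {R : Rel a x} {Q : Rel b y} → Square R (rel-+ R Q) C.i₁ D.i₁
      sq-i₂    : ∀ {a b x y} {R : Rel a x} {Q : Rel b y} → Square Q (rel-+ R Q) C.i₂ D.i₂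
      sq-[]    : ∀ {a b c x y z} {R : Rel a x} {Q : Rel b y} {P : Rel c z} {f g α β} →
                 Square R P f α → Square Q P g β →
                 Square (rel-+ R Q) P C.[ f , g ] D.[ α , β ]
      sq-eval  : ∀ {a b x y} {R : Rel a x} {Q : Rel b y} →
                 Square (rel-× (rel-⇒ R Q) R) Q C.eval D.eval
      sq-curry : ∀ {a b c x y z} {R : Rel a x} {Q : Rel b y} {P : Rel c z} {f α} →
                 Square (rel-× R Q) P f α → Square R (rel-⇒ Q P) (C.curry f) (D.curry α)

module FundamentalLemma {o m e o' m' e' r s} {𝒞 : Category o m e} {S : BCCStructure 𝒞}
                        {𝒟 : Category o' m' e'} {T : BCCStructure 𝒟}
                        (L : LogicalRelation 𝒞 S 𝒟 T r s) {Base : Set}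
                        (ρ : Base → Category.Obj 𝒞) (σ : Base → Category.Obj 𝒟)
                        (rel-ι : ∀ b → LogicalRelation.Rel L (ρ b) (σ b)) where
  open LogicalRelation L
  private
    module ⟦C⟧ = Interpretation 𝒞 S ρ
    module ⟦D⟧ = Interpretation 𝒟 T σ

  rel-ty : ∀ A → Rel ⟦C⟧.⟦ A ⟧ty ⟦D⟧.⟦ A ⟧ty
  rel-ty (ι b)   = rel-ι b
  rel-ty 𝟙       = rel-⊤
  rel-ty 𝟘       = rel-⊥
  rel-ty (A ⊗ B) = rel-× (rel-ty A) (rel-ty B)
  rel-ty (A ⊕ B) = rel-+ (rel-ty A) (rel-ty B)
  rel-ty (A ⇛ B) = rel-⇒ (rel-ty A) (rel-ty B)

  rel-ctx : ∀ Γ → Rel ⟦C⟧.⟦ Γ ⟧ctx ⟦D⟧.⟦ Γ ⟧ctx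
  rel-ctx ε       = rel-⊤
  rel-ctx (Γ ▸ A) = rel-× (rel-ctx Γ) (rel-ty A)

  sq-var : ∀ {Γ A} (i : Γ ∋ A) → Square (rel-ctx Γ) (rel-ty A) ⟦C⟧.⟦ i ⟧var ⟦D⟧.⟦ i ⟧var
  sq-var ze     = sq-π₂
  sq-var (su i) = sq-∘ (sq-var i) sq-π₁

  sq-tm : ∀ {Γ A} (M : Tm Γ A) → Square (rel-ctx Γ) (rel-ty A) ⟦C⟧.⟦ M ⟧ ⟦D⟧.⟦ M ⟧
  sq-tm (var i)      = sq-var i
  sq-tm unit         = sq-!
  sq-tm (pair M N)   = sq-⟨⟩ (sq-tm M) (sq-tm N)
  sq-tm (fst M)      = sq-∘ sq-π₁ (sq-tm M)
  sq-tm (snd M)      = sq-∘ sq-π₂ (sq-tm M)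
  sq-tm (absurd M)   = sq-∘ sq-eval (sq-⟨⟩ (sq-∘ sq-¡ (sq-tm M)) sq-id)
  sq-tm (inl M)      = sq-∘ sq-i₁ (sq-tm M)
  sq-tm (inr M)      = sq-∘ sq-i₂ (sq-tm M)
  sq-tm (case M N O) = sq-∘ sq-eval (sq-⟨⟩ (sq-∘
    (sq-[] (sq-curry (sq-∘ (sq-tm N) (sq-⟨⟩ sq-π₂ sq-π₁)))
           (sq-curry (sq-∘ (sq-tm O) (sq-⟨⟩ sq-π₂ sq-π₁)))) (sq-tm M)) sq-id)
  sq-tm (lam M)      = sq-curry (sq-tm M)
  sq-tm (app M N)    = sq-∘ sq-eval (sq-⟨⟩ (sq-tm M) (sq-tm N))

-- Representability as a logical relation, and faithfulness.

module Embedding {ℓ} (𝒞 : Category ℓ ℓ ℓ) (S : BCCStructure 𝒞) where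
  open BCCStructure S using (products; coproducts; exponentials)
  open BCCOperations 𝒞 S
  open HomReasoning 𝒞 using (refl; sym; trans; ∘-resp-≈ˡ; ∘-resp-≈ʳ; pullˡ)
  open ProductProperties 𝒞 products
  open CoproductProperties 𝒞 coproducts
  open ExponentialProperties 𝒞 exponentials
  open BCCDistributive 𝒞 S using (distributive)
  open PresheafBCC 𝒞 distributive
  open ProdPresheaf
  open NatTrans

  private module P = BCCOperations (PSh× 𝒞 distributive ℓ) bcc

  -- An isomorphism `y a ≅ F`. Naturality of `from` is derived, as the inverse of a natural
  -- bijection is natural.
  record Represents (a : Obj) (F : Psh) : Set ℓ where
    no-eta-equality
    private module F {c} = Setoid (F₀ F c)
    field
      to        : y a ⟶ F
      from      : ∀ {c} → ∣ F ∣ c → Hom c a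
      from-cong : ∀ {c} {u v : ∣ F ∣ c} → u F.≈ v → from u ≈ from v
      from-to   : ∀ {c} (h : Hom c a) → from (η to c h) ≈ h
      to-from   : ∀ {c} (u : ∣ F ∣ c) → η to c (from u) F.≈ u

    elem : ∀ {c} → Hom c a → ∣ F ∣ c
    elem {c} h = η to c h

    elem-cong : ∀ {c} {h k : Hom c a} → h ≈ k → elem h F.≈ elem k
    elem-cong {c} p = η-cong to c p

    elem-natural : ∀ {c d} (f : Hom c d) (h : Hom d a) → elem (h ∘ f) F.≈ F₁ F f (elem h)
    elem-natural f h = natural to f h

    from-natural : ∀ {c d} (f : Hom c d) (u : ∣ F ∣ d) → from (F₁ F f u) ≈ from u ∘ f
    from-natural f u = trans
      (from-cong (F.trans (F₁-cong F f (F.sym (to-from u))) (F.sym (elem-natural f (from u)))))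
      (from-to (from u ∘ f))

  open Represents

  represents-y : ∀ a → Represents a (y a)
  represents-y a .to          = P.id
  represents-y a .from h      = h
  represents-y a .from-cong p = p
  represents-y a .from-to _   = refl
  represents-y a .to-from _   = refl

  represents-⊤ : Represents ⊤ P.⊤
  represents-⊤ .to          = P.!
  represents-⊤ .from _      = !
  represents-⊤ .from-cong _ = refl
  represents-⊤ .from-to h   = sym (!-unique h)
  represents-⊤ .to-from _   = tt

  module _ {a b : Obj} {F G : Psh} (R : Represents a F) (Q : Represents b G) where
    private
      module R = Represents R
      module Q = Represents Q
      module F {c} = Setoid (F₀ F c)
      module G {c} = Setoid (F₀ G c)
      module F+G {c} = Setoid (F₀ (F P.+ G) c)

    represents-× : Represents (a × b) (F P.× G)
    represents-× .to = record
      { η       = λ c h → R.elem (π₁ ∘ h) , Q.elem (π₂ ∘ h)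
      ; η-cong  = λ c p → R.elem-cong (∘-resp-≈ʳ p) , Q.elem-cong (∘-resp-≈ʳ p)
      ; natural = λ f h → F.trans (R.elem-cong (sym assoc)) (R.elem-natural f (π₁ ∘ h))
                        , G.trans (Q.elem-cong (sym assoc)) (Q.elem-natural f (π₂ ∘ h))
      }
    represents-× .from (u , v)      = ⟨ R.from u , Q.from v ⟩
    represents-× .from-cong (p , q) = ⟨⟩-cong (R.from-cong p) (Q.from-cong q)
    represents-× .from-to h         = sym (⟨⟩-unique h (sym (R.from-to _)) (sym (Q.from-to _)))
    represents-× .to-from (u , v)   = F.trans (R.elem-cong π₁-β) (R.to-from u)
                                    , G.trans (Q.elem-cong π₂-β) (Q.to-from v)

    -- By Yoneda, a map `y (a + b) ⟶ (F P.+ G)` is an element over `a + b`. A pointwise disjoint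
    -- union offers only elements lying wholly in `F` or in `G`; `join` supplies the mixed one.
    generic-sum : ∣ F P.+ G ∣ (a + b)
    generic-sum = join (inj₁ (R.elem id)) (inj₂ (Q.elem id))

    inj₁-elem : ∀ {c} (h : Hom c a) → inj₁ (R.elem h) F+G.≈ act (i₁ ∘ h) generic-sum
    inj₁-elem h = F+G.trans (inj₁-cong (R.elem-cong (sym identityˡ)))
      (F+G.trans (inj₁-cong (R.elem-natural h id)) (F+G.trans (inj₁-natural h _)
        (F+G.sym (F+G.trans (act-∘ h i₁ _) (act-cong h (join-β₁ _ _))))))

    inj₂-elem : ∀ {c} (h : Hom c b) → inj₂ (Q.elem h) F+G.≈ act (i₂ ∘ h) generic-sum
    inj₂-elem h = F+G.trans (inj₂-cong (Q.elem-cong (sym identityˡ)))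
      (F+G.trans (inj₂-cong (Q.elem-natural h id)) (F+G.trans (inj₂-natural h _)
        (F+G.sym (F+G.trans (act-∘ h i₂ _) (act-cong h (join-β₂ _ _))))))

    to-sum : y (a + b) ⟶ (F P.+ G)
    to-sum = record
      { η       = λ c h → act h generic-sum
      ; η-cong  = λ c p → act-resp-≈ _ p
      ; natural = λ f h → act-∘ f h _
      }

    from-sum : (F P.+ G) ⟶ y (a + b)
    from-sum = P.[ record { η       = λ c u → i₁ ∘ R.from u
                          ; η-cong  = λ c p → ∘-resp-≈ʳ (R.from-cong p)
                          ; natural = λ f u → trans (∘-resp-≈ʳ (R.from-natural f u)) (sym assoc) }
                 , record { η       = λ c u → i₂ ∘ Q.from u
                          ; η-cong  = λ c p → ∘-resp-≈ʳ (Q.from-cong p)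
                          ; natural = λ f u → trans (∘-resp-≈ʳ (Q.from-natural f u)) (sym assoc) } ]

    represents-+ : Represents (a + b) (F P.+ G)
    represents-+ .to            = to-sum
    represents-+ .from {c}      = η from-sum c
    represents-+ .from-cong {c} = η-cong from-sum c
    -- By computation of `extend`, the left side is `[ i₁ ∘ R.from (R.elem id) , i₂ ∘ Q.from (Q.elem
    -- id) ] ∘ h`; it remains to see that the copairing is `id`.
    represents-+ .from-to h     = trans (∘-resp-≈ˡ ([]-ext
      (trans i₁-β (trans (trans (∘-resp-≈ʳ (R.from-to id)) identityʳ) (sym identityˡ)))
      (trans i₂-β (trans (trans (∘-resp-≈ʳ (Q.from-to id)) identityʳ) (sym identityˡ)))))
      identityˡ
    -- Uniqueness of copairing replaces an induction on `Free`: two natural maps are compared on the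
    -- injections only.
    represents-+ .to-from {c}   = CoproductProperties.[]-ext (PSh× 𝒞 distributive ℓ) coproductsᴾ
      {h = to-sum P.∘ from-sum} {k = P.id}
      (λ _ u → F+G.trans (F+G.sym (inj₁-elem _)) (inj₁-cong (R.to-from u)))
      (λ _ u → F+G.trans (F+G.sym (inj₂-elem _)) (inj₂-cong (Q.to-from u))) c

    open Family

    evaluation : ∀ {c} → Hom c (a ⇒ b) → Family F G c
    evaluation h = record
      { at         = λ f u → Q.elem (eval ∘ ⟨ h ∘ f , R.from u ⟩)
      ; at-cong    = λ p q → Q.elem-cong (∘-resp-≈ʳ (⟨⟩-cong (∘-resp-≈ʳ p) (R.from-cong q)))
      ; at-natural = λ g f u → G.trans
          (Q.elem-cong (trans (∘-resp-≈ʳ (trans (⟨⟩-cong (sym assoc) (R.from-natural g u)) (sym ⟨⟩∘)))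
                              (sym assoc)))
          (Q.elem-natural g _)
      }

    -- The uncurried representing map: `φ` at the universal argument over `c × a`, read back in 𝒞.
    body : ∀ {c} → Family F G c → Hom (c × a) b
    body φ = Q.from (at φ π₁ (R.elem π₂))

    represents-⇒ : Represents (a ⇒ b) (F P.⇒ G)
    represents-⇒ .to = record
      { η       = λ c → evaluation
      ; η-cong  = λ c p f u → Q.elem-cong (∘-resp-≈ʳ (⟨⟩-cong (∘-resp-≈ˡ p) refl))
      ; natural = λ f h g u → Q.elem-cong (∘-resp-≈ʳ (⟨⟩-cong assoc refl))
      }
    represents-⇒ .from φ        = curry (body φ)
    represents-⇒ .from-cong p   = curry-cong (Q.from-cong (p π₁ (R.elem π₂)))
    represents-⇒ .from-to h     = sym (curry-unique h (sym (trans (Q.from-to _)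
      (∘-resp-≈ʳ (⟨⟩-cong refl (trans (R.from-to π₂) (sym identityˡ)))))))
    -- The map `k` classifies the argument pair of `f` and `u`, so naturality of `φ` along `k`
    -- carries its universal value to the value at `f` and `u`.
    represents-⇒ .to-from φ f u = begin
      Q.elem (eval ∘ ⟨ curry (body φ) ∘ f , R.from u ⟩) ≈⟨ Q.elem-cong eval-curry ⟩
      Q.elem (body φ ∘ k)                               ≈⟨ Q.elem-natural k (body φ) ⟩
      F₁ G k (Q.elem (body φ))                          ≈⟨ F₁-cong G k (Q.to-from _) ⟩
      F₁ G k (at φ π₁ (R.elem π₂))                      ≈⟨ at-natural φ k π₁ (R.elem π₂) ⟨
      at φ (π₁ ∘ k) (F₁ F k (R.elem π₂))                ≈⟨ at-cong φ π₁-β (F.sym (R.elem-natural k π₂)) ⟩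
      at φ f (R.elem (π₂ ∘ k))                          ≈⟨ at-cong φ refl (F.trans (R.elem-cong π₂-β) (R.to-from u)) ⟩
      at φ f u                                          ∎
      where
      open SetoidReasoning (F₀ G _)
      k = ⟨ f , R.from u ⟩

  -- A record rather than a bare function type, so that unification can read `R`, `Q`, `f` and `α`
  -- off it.
  record Tracks {a b F G} (R : Represents a F) (Q : Represents b G)
                (f : Hom a b) (α : F ⟶ G) : Set ℓ where
    field
      square : ∀ {c} (h : Hom c a) → Setoid._≈_ (F₀ G c) (η α c (elem R h)) (elem Q (f ∘ h))

  open Tracks

  module _ {a F} {R : Represents a F} where
    private module F {c} = Setoid (F₀ F c)

    tracks-id : Tracks R R id P.id
    tracks-id .square h = elem-cong R (sym identityˡ)

    tracks-! : Tracks R represents-⊤ ! P.!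
    tracks-! .square h = tt

    tracks-¡ : Tracks (represents-y ⊥) R ¡ P.¡
    tracks-¡ .square h = F.trans (F₁-cong F h (F.sym (F⊥-contr F _))) (F.sym (elem-natural R h ¡))

  module _ {a b c F G H} {R : Represents a F} {Q : Represents b G} {T : Represents c H} where
    private
      module G {d} = Setoid (F₀ G d)
      module H {d} = Setoid (F₀ H d)

    tracks-∘ : ∀ {f g α β} → Tracks Q T g β → Tracks R Q f α → Tracks R T (g ∘ f) (β P.∘ α)
    tracks-∘ {β = β} q p .square h = H.trans (η-cong β _ (square p h))
      (H.trans (square q _) (elem-cong T (sym assoc)))

    tracks-⟨⟩ : ∀ {f g α β} → Tracks R Q f α → Tracks R T g β →
                Tracks R (represents-× Q T) ⟨ f , g ⟩ P.⟨ α , β ⟩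
    tracks-⟨⟩ p q .square h = G.trans (square p h) (elem-cong Q (sym (pullˡ π₁-β)))
                            , H.trans (square q h) (elem-cong T (sym (pullˡ π₂-β)))

    -- On `act h generic-sum` the presheaf copairing computes to a glued element restricted along
    -- `h`. So it suffices to identify that glued element with `elem T [ f , g ]`, which
    -- `glue-unique` does from the squares `p` and `q` at `id`.
    tracks-[] : ∀ {f g α β} → Tracks R T f α → Tracks Q T g β →
                Tracks (represents-+ R Q) T [ f , g ] P.[ α , β ]
    tracks-[] {f} {g} p q .square h = H.trans
      (F₁-cong H h (H.sym (glue-unique H _ (along p i₁-β) (along q i₂-β))))
      (H.sym (elem-natural T h f+g))
      where
      f+g : Hom (a + b) c
      f+g = [ f , g ]

      along : ∀ {d K} {U : Represents d K} {j : Hom d (a + b)} {k γ} → Tracks U T k γ →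
              f+g ∘ j ≈ k → F₁ H j (elem T f+g) H.≈ η γ d (elem U id)
      along r s = H.trans (H.sym (elem-natural T _ f+g))
        (H.trans (elem-cong T (trans s (sym identityʳ))) (H.sym (square r id)))

    tracks-curry : ∀ {f α} → Tracks (represents-× R Q) T f α →
                   Tracks R (represents-⇒ Q T) (curry f) (P.curry α)
    -- `α` is applied to `elem R h` restricted along `k`, paired with `u`; `v` is the map
    -- representing that pair.
    tracks-curry {f} {α} p .square h k u = let v = ⟨ h ∘ k , from Q u ⟩ in
      H.trans
        (η-cong α _ ( Setoid.trans (F₀ F _) (Setoid.sym (F₀ F _) (elem-natural R k h)) (elem-cong R (sym π₁-β))
                    , G.trans (G.sym (to-from Q u)) (elem-cong Q (sym π₂-β))))
        (H.trans (square p v)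
          (elem-cong T (sym (trans (∘-resp-≈ʳ (⟨⟩-cong assoc refl)) eval-curry))))

  module _ {a b F G} {R : Represents a F} {Q : Represents b G} where
    private module G {d} = Setoid (F₀ G d)

    tracks-π₁ : Tracks (represents-× R Q) R π₁ P.π₁
    tracks-π₁ .square h = Setoid.refl (F₀ F _)

    tracks-π₂ : Tracks (represents-× R Q) Q π₂ P.π₂
    tracks-π₂ .square h = G.refl

    tracks-i₁ : Tracks R (represents-+ R Q) i₁ P.i₁
    tracks-i₁ .square = inj₁-elem R Q

    tracks-i₂ : Tracks Q (represents-+ R Q) i₂ P.i₂
    tracks-i₂ .square = inj₂-elem R Q

    tracks-eval : Tracks (represents-× (represents-⇒ R Q) R) Q eval P.eval
    tracks-eval .square h = elem-cong Q (∘-resp-≈ʳ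
      (sym (⟨⟩-unique h (sym identityʳ) (sym (from-to R (π₂ ∘ h))))))

  -- Evaluation at the universal element `elem R id` suffices: the squares send it to the elements
  -- represented by `f` and `g`, and `from Q` recovers these maps.
  tracks-reflects : ∀ {a b F G} {R : Represents a F} {Q : Represents b G} {f g α β} →
                    Tracks R Q f α → Tracks R Q g β →
                    (∀ c u → Setoid._≈_ (F₀ G c) (η α c u) (η β c u)) → f ≈ g
  tracks-reflects {G = G} {R} {Q} p q r = trans (sym identityʳ) (trans (sym (from-to Q _))
    (trans (from-cong Q (G.trans (G.sym (square p id)) (G.trans (r _ _) (square q id))))
      (trans (from-to Q _) identityʳ)))
    where module G {c} = Setoid (F₀ G c)

  relation : LogicalRelation 𝒞 S (PSh× 𝒞 distributive ℓ) bcc _ _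
  relation = record
    { Rel    = Represents
    ; Square = Tracks
    ; rel-⊤  = represents-⊤
    ; rel-⊥  = represents-y ⊥
    ; rel-×  = represents-×
    ; rel-+  = represents-+
    ; rel-⇒  = represents-⇒
    ; sq-id  = tracks-id
    ; sq-∘   = tracks-∘
    ; sq-!   = tracks-!
    ; sq-¡   = tracks-¡
    ; sq-π₁  = tracks-π₁
    ; sq-π₂  = tracks-π₂
    ; sq-⟨⟩  = tracks-⟨⟩
    ; sq-i₁  = tracks-i₁
    ; sq-i₂  = tracks-i₂
    ; sq-[]  = tracks-[]
    ; sq-eval  = tracks-eval
    ; sq-curry = tracks-curry
    }

  module _ {Base : Set} (ρ : Base → Obj) where
    open FundamentalLemma relation ρ (λ b → y (ρ b)) (λ b → represents-y (ρ b))

    presheaf-reflects : ∀ {Γ A} (M N : Tm Γ A) →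
      Category._≈_ (PSh× 𝒞 distributive ℓ) ⟦ M ⟧⟨ bcc , (λ b → y (ρ b)) ⟩ ⟦ N ⟧⟨ bcc , (λ b → y (ρ b)) ⟩ →
      ⟦ M ⟧⟨ S , ρ ⟩ ≈ ⟦ N ⟧⟨ S , ρ ⟩
    presheaf-reflects M N = tracks-reflects (sq-tm M) (sq-tm N)

theorem5p5 : ∀ {ℓ : Level} (Base : Set) → BCCComplete ℓ Base →
    ∀ {Γ : Ctx Base} {A : Ty Base} (M N : Tm Γ A) →
    (∀ (𝒞 : Category ℓ ℓ ℓ) (D : DistributiveStructure 𝒞)
    (S : BCCStructure (PSh× 𝒞 D ℓ)) (ρ : Base → ProdPresheaf 𝒞 D ℓ) →
    Category._≈_ (PSh× 𝒞 D ℓ) ⟦ M ⟧⟨ S , ρ ⟩ ⟦ N ⟧⟨ S , ρ ⟩) →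
    M ≈βη N
theorem5p5 Base complete M N equal = complete M N λ 𝒞 S ρ →
  -- The holes are solved by the distributive structure induced by `S` and by the interpretation of
  -- base types as the representables `y (ρ b)`.
  Embedding.presheaf-reflects 𝒞 S ρ M N (equal 𝒞 _ (PresheafBCC.bcc 𝒞 _) _)
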